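{- The face graph $\mathcal F(X)$ of a face-transitive surface $X$ is node-transitive, i.e. the automorphism group of the graph $\mathcal F(X)$ acts transitively on its nodes.
   Context: A simplicial complex $X$ on a finite non-empty set $P$ is a non-empty family of subsets of $P$ closed under taking subsets; $X_i$ is the set of its elements of cardinality $i+1$; elements of $X_0,X_1,X_2$ are vertices, edges, faces. A simplicial surface is a simplicial complex $X$ such that: all inclusion-maximal elements have cardinality $3$; every edge lies in exactly two faces; and for every vertex $v$ the faces containing $v$ can be arranged in a cyclic sequence $(F_1,\dots,F_n)$ (each once) with $|F_i\cap F_{i+1}|=2$ (subscripts mod $n$). Simplicial surfaces are assumed strongly connected (any two faces joined by a sequence of faces with consecutive ones sharing an edge). $\mathrm{Aut}(X)$ is the automorphism group (permutations of $X_0$ mapping faces to faces). $X$ is face-transitive if $\mathrm{Aut}(X)$ is transitive on $X_2$. The face graph $\mathcal F(X)$ is the graph with node set $X_2$ in which two faces are joined iff they share an edge of $X$. -}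

module Defs where

open import Data.Bool using (Bool; T)
open import Data.Nat using (ℕ; suc; NonZero)
open import Data.Nat.DivMod using (_mod_)
open import Data.Fin using (Fin; toℕ)
open import Data.Fin.Subset using (Subset; _∈_; _⊆_; _∩_; ∣_∣)
open import Data.Product using (Σ-syntax; ∃-syntax; _×_; _,_; proj₁)
open import Data.Sum using (_⊎_)
open import Function.Bundles using (_↔_; _⇔_; module Inverse)
open import Function.Definitions using (Injective)
open import Relation.Binary.Construct.Closure.ReflexiveTransitive using (Star)
open import Relation.Binary.Definitions using (Irreflexive; Symmetric)
open import Relation.Binary.PropositionalEquality using (_≡_; _≢_; sym)

-- The underlying non-empty set P is Fin n.  The family is given by its
-- characteristic function, so that membership is decidable and proofs of
-- membership are unique.
record SimplicialComplex (n : ℕ) .{{_ : NonZero n}} : Set where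
  field
    family   : Subset n → Bool
    nonEmpty : ∃[ s ] T (family s)
    closed   : ∀ {s t} → s ⊆ t → T (family t) → T (family s)

module _ {n : ℕ} .{{_ : NonZero n}} (X : SimplicialComplex n) where

  open SimplicialComplex X

  -- Both components after the subset are propositions, so equality of
  -- simplices is equality of the underlying subsets.
  Simplex : ℕ → Set
  Simplex i = Σ[ s ∈ Subset n ] (T (family s) × ∣ s ∣ ≡ suc i)

  -- A vertex is a singleton, not an element of P, so "v is a vertex of F"
  -- reads  proj₁ v ⊆ proj₁ F.
  Vertex Edge Face : Set
  Vertex = Simplex 0
  Edge   = Simplex 1
  Face   = Simplex 2

  _⊑_ : ∀ {i j} → Simplex i → Simplex j → Set
  σ ⊑ τ = proj₁ σ ⊆ proj₁ τ

  Maximal : Subset n → Set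
  Maximal s = T (family s) × (∀ t → T (family t) → s ⊆ t → t ≡ s)

  ShareEdge : Face → Face → Set
  ShareEdge F G = Σ[ e ∈ Edge ] (e ⊑ F × e ⊑ G)

  InExactlyTwoFaces : Edge → Set
  InExactlyTwoFaces e =
    Σ[ F ∈ Face ] Σ[ G ∈ Face ] (F ≢ G × (∀ (H : Face) → (e ⊑ H) ⇔ (H ≡ F ⊎ H ≡ G)))

  record CyclicFaceSequence (v : Vertex) : Set where
    field
      length      : ℕ
      {{nonZero}} : NonZero length
      face        : Fin length → Face
      once        : Injective _≡_ _≡_ face
      enumerates  : ∀ (F : Face) → (v ⊑ F) ⇔ (∃[ i ] face i ≡ F)
      consecutive : ∀ i →
        ∣ proj₁ (face i) ∩ proj₁ (face (suc (toℕ i) mod length)) ∣ ≡ 2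

  record IsSimplicialSurface : Set where
    field
      pure              : ∀ s → Maximal s → ∣ s ∣ ≡ 3
      edgeInTwoFaces    : ∀ (e : Edge) → InExactlyTwoFaces e
      cyclicAtVertices  : ∀ (v : Vertex) → CyclicFaceSequence v
      stronglyConnected : ∀ (F G : Face) → Star ShareEdge F G

  -- t is the image of the simplex s under the vertex map f, i.e. the union
  -- of the singletons f v over the vertices v of s.
  IsImage : (Vertex → Vertex) → Subset n → Subset n → Set
  IsImage f s t = ∀ p → (p ∈ t) ⇔ (Σ[ v ∈ Vertex ] (proj₁ v ⊆ s × p ∈ proj₁ (f v)))

  record ComplexAut : Set where
    field
      permutation : Vertex ↔ Vertex

    open Inverse permutation public using (to; from)

    field
      mapsFaces : ∀ (F : Face) → Σ[ G ∈ Face ] IsImage to (proj₁ F) (proj₁ G)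

  FaceTransitive : Set
  FaceTransitive = ∀ (F G : Face) →
    Σ[ α ∈ ComplexAut ] IsImage (ComplexAut.to α) (proj₁ F) (proj₁ G)

record Graph : Set₁ where
  field
    Node        : Set
    Adj         : Node → Node → Set
    symmetric   : Symmetric Adj
    irreflexive : Irreflexive _≡_ Adj

module _ (Γ : Graph) where

  open Graph Γ

  record GraphAut : Set where
    field
      permutation : Node ↔ Node

    open Inverse permutation public using (to; from)

    field
      adjacency : ∀ u v → Adj u v ⇔ Adj (to u) (to v)

  NodeTransitive : Set
  NodeTransitive = ∀ (u v : Node) → Σ[ φ ∈ GraphAut ] GraphAut.to φ u ≡ v

-- Distinctness is required for adjacency since every face trivially shares
-- an edge with itself.
faceGraph : ∀ {n} .{{_ : NonZero n}} → SimplicialComplex n → Graph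
faceGraph X = record
  { Node        = Face X
  ; Adj         = λ F G → F ≢ G × ShareEdge X F G
  ; symmetric   = λ (F≢G , e , e⊑F , e⊑G) → (λ G≡F → F≢G (sym G≡F)) , e , e⊑G , e⊑F
  ; irreflexive = λ F≡G (F≢G , _) → F≢G F≡G
  }

{-# OPTIONS --safe #-}

-- A complex automorphism induces an injective map on faces, hence a
-- permutation of the finite set of faces.  It preserves adjacency in both
-- directions because sharing an edge is the same as sharing two distinct
-- vertices, a condition that a vertex permutation transports without any
-- counting of images.

module Submission where

open import Defs
open import Data.Bool.Properties using (T-irrelevant)
open import Data.Fin using (Fin; zero; suc; toℕ; funToFin; finToFun)
import Data.Fin.Properties as Fin
open import Data.Fin.Subset using (Subset; inside; outside; _∈_; _⊆_; ⁅_⁆; _∪_; ∣_∣; Nonempty)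
open import Data.Fin.Subset.Properties using (nonempty?; Empty-unique; ∣⊥∣≡0; ∣⁅x⁆∣≡1; x∈⁅x⁆; x∈⁅y⁆⇒x≡y; ∪-identityˡ; ∪-identityʳ; x∈p∪q⁻; p⊆q⇒∣p∣≤∣q∣; ⊆-antisym)
open import Data.Nat using (ℕ; zero; suc; _<_; _≤_; _^_; z<s; s<s; s≤s; NonZero)
open import Data.Nat.GeneralisedArithmetic using (fold)
import Data.Nat.Properties as ℕ
open import Data.Product using (Σ-syntax; ∃-syntax; _×_; _,_; proj₁; proj₂)
open import Data.Sum using ([_,_]′)
open import Data.Vec using (lookup; _∷_; here; there)
open import Data.Vec.Relation.Binary.Pointwise.Extensional using (Pointwise-≡⇒≡; ext)
open import Function using (_∘_)
open import Function.Bundles using (_⇔_; mk⇔; mk↔ₛ′; module Equivalence; module Injection; module Inverse)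
open import Function.Definitions using (Injective; StrictlySurjective)
open import Function.Properties.Inverse using (↔⇒↣; ↔-sym)
open import Relation.Binary.PropositionalEquality using (_≡_; _≢_; refl; sym; trans; cong; subst; module ≡-Reasoning)
open import Relation.Nullary using (yes; no; contradiction)
open import Relation.Nullary.Decidable using (decidable-stable)

private
  variable
    A : Set
    m n : ℕ

-- Injectivity cancels one `f` from both sides until the shorter iterate is `x` itself. The longer
-- one still ends in an application of `f`, and its argument is the preimage.
fold-collision⇒preimage : {f : A → A} → Injective _≡_ _≡_ f →
  ∀ {x i j} → i < j → fold x f i ≡ fold x f j → ∃[ y ] f y ≡ x
fold-collision⇒preimage {f = f} f-inj {x} {zero}  {suc j} z<s       eq = fold x f j , sym eq
fold-collision⇒preimage         f-inj {_} {suc i} {suc j} (s<s i<j) eq = fold-collision⇒preimage f-inj i<j (f-inj eq)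

-- Finiteness enters only through an injection into some `Fin m`, so no enumeration of `A` is
-- required. Among `m + 1` iterates of `f` at `x`, two have the same code.
finite-injective⇒surjective : (code : A → Fin m) → Injective _≡_ _≡_ code →
  (f : A → A) → Injective _≡_ _≡_ f → StrictlySurjective _≡_ f
finite-injective⇒surjective code code-inj f f-inj x =
  let i , j , i<j , eq = Fin.pigeonhole (ℕ.n<1+n _) (λ i → code (fold x f (toℕ i)))
  in fold-collision⇒preimage f-inj i<j (code-inj eq)

-- The characteristic vector is read as the digits of a number in base 2.
encode : Subset n → Fin (2 ^ n)
encode s = funToFin (Inverse.from Fin.2↔Bool ∘ lookup s)

encode-injective : Injective _≡_ _≡_ (encode {n})
encode-injective {x = s} {y = t} eq = Pointwise-≡⇒≡ (ext λ i → bit-injective (begin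
  bit (lookup s i)        ≡⟨ Fin.finToFun-funToFin (bit ∘ lookup s) i ⟨
  finToFun (encode s) i   ≡⟨ cong (λ k → finToFun k i) eq ⟩
  finToFun (encode t) i   ≡⟨ Fin.finToFun-funToFin (bit ∘ lookup t) i ⟩
  bit (lookup t i)        ∎))
  where
  open ≡-Reasoning
  open Injection (↔⇒↣ (↔-sym Fin.2↔Bool)) using () renaming (to to bit; injective to bit-injective)

∣p∣>0⇒nonempty : (s : Subset n) → 0 < ∣ s ∣ → Nonempty s
∣p∣>0⇒nonempty {n} s 0<∣s∣ with nonempty? s
... | yes ne = ne
... | no  em = contradiction (sym (trans (cong ∣_∣ (Empty-unique em)) (∣⊥∣≡0 n))) (ℕ.<⇒≢ 0<∣s∣)

∣p∣>1⇒distinct : (s : Subset n) → 1 < ∣ s ∣ → ∃[ p ] ∃[ q ] (p ≢ q × p ∈ s × q ∈ s)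
∣p∣>1⇒distinct (inside ∷ s) (s<s 0<∣s∣) =
  let q , q∈s = ∣p∣>0⇒nonempty s 0<∣s∣
  in zero , suc q , (λ ()) , here , there q∈s
∣p∣>1⇒distinct (outside ∷ s) 1<∣s∣ =
  let p , q , p≢q , p∈s , q∈s = ∣p∣>1⇒distinct s 1<∣s∣
  in suc p , suc q , p≢q ∘ Fin.suc-injective , there p∈s , there q∈s

∣⁅x⁆∪⁅y⁆∣≡2 : {p q : Fin n} → p ≢ q → ∣ ⁅ p ⁆ ∪ ⁅ q ⁆ ∣ ≡ 2
∣⁅x⁆∪⁅y⁆∣≡2 {p = zero}  {zero}  p≢q = contradiction refl p≢q
∣⁅x⁆∪⁅y⁆∣≡2 {p = zero}  {suc q} p≢q = cong suc (trans (cong ∣_∣ (∪-identityˡ ⁅ q ⁆)) (∣⁅x⁆∣≡1 q))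
∣⁅x⁆∪⁅y⁆∣≡2 {p = suc p} {zero}  p≢q = cong suc (trans (cong ∣_∣ (∪-identityʳ ⁅ p ⁆)) (∣⁅x⁆∣≡1 p))
∣⁅x⁆∪⁅y⁆∣≡2 {p = suc p} {suc q} p≢q = ∣⁅x⁆∪⁅y⁆∣≡2 (p≢q ∘ cong suc)

⁅x⁆⊆p : {p : Fin n} {s : Subset n} → p ∈ s → ⁅ p ⁆ ⊆ s
⁅x⁆⊆p {s = s} p∈s x∈ = subst (_∈ s) (sym (x∈⁅y⁆⇒x≡y _ x∈)) p∈s

⁅x⁆∪⁅y⁆⊆p : {p q : Fin n} {s : Subset n} → p ∈ s → q ∈ s → ⁅ p ⁆ ∪ ⁅ q ⁆ ⊆ s
⁅x⁆∪⁅y⁆⊆p p∈s q∈s x∈ = [ ⁅x⁆⊆p p∈s , ⁅x⁆⊆p q∈s ]′ (x∈p∪q⁻ _ _ x∈)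

-- Two distinct points would span a subset of `s` with two elements, forcing `2 ≤ 1`.
∣p∣≡1⇒unique : {s : Subset n} → ∣ s ∣ ≡ 1 → ∀ {p q} → p ∈ s → q ∈ s → p ≡ q
∣p∣≡1⇒unique ∣s∣≡1 {p} {q} p∈s q∈s = decidable-stable (p Fin.≟ q) λ p≢q →
  contradiction (subst (2 ≤_) ∣s∣≡1 (subst (_≤ _) (∣⁅x⁆∪⁅y⁆∣≡2 p≢q) (p⊆q⇒∣p∣≤∣q∣ (⁅x⁆∪⁅y⁆⊆p p∈s q∈s))))
    λ where (s≤s ())

module _ .{{_ : NonZero n}} (X : SimplicialComplex n) where

  open SimplicialComplex X

  private
    _≼_ : ∀ {i j} → Simplex X i → Simplex X j → Set
    _≼_ = _⊑_ X

  simplex-≡ : ∀ {i} {σ τ : Simplex X i} → proj₁ σ ≡ proj₁ τ → σ ≡ τ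
  simplex-≡ {σ = s , a , b} {τ = _ , a′ , b′} refl
    rewrite T-irrelevant a a′ | ℕ.≡-irrelevant b b′ = refl

  simplex-encode-injective : ∀ {i} → Injective _≡_ _≡_ (λ (σ : Simplex X i) → encode (proj₁ σ))
  simplex-encode-injective = simplex-≡ ∘ encode-injective

  point : (v : Vertex X) → Nonempty (proj₁ v)
  point (s , _ , ∣s∣≡1) = ∣p∣>0⇒nonempty s (subst (0 <_) (sym ∣s∣≡1) z<s)

  -- Vertices are singletons, so one common point identifies them. This is how equations between
  -- vertices are extracted from statements about points of `Fin n`.
  vertex-≡ : {v w : Vertex X} → ∀ {p} → p ∈ proj₁ v → p ∈ proj₁ w → v ≡ w
  vertex-≡ {v} {w} p∈v p∈w = simplex-≡ (⊆-antisym (inclusion v w p∈v p∈w) (inclusion w v p∈w p∈v))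
    where
    inclusion : ∀ (v w : Vertex X) {p} → p ∈ proj₁ v → p ∈ proj₁ w → proj₁ v ⊆ proj₁ w
    inclusion v w p∈v p∈w q∈v = subst (_∈ proj₁ w) (∣p∣≡1⇒unique (proj₂ (proj₂ v)) p∈v q∈v) p∈w

  vertexAt : ∀ {i} (σ : Simplex X i) {p} → p ∈ proj₁ σ → Vertex X
  vertexAt (s , s∈X , _) {p} p∈s = ⁅ p ⁆ , closed (⁅x⁆⊆p p∈s) s∈X , ∣⁅x⁆∣≡1 p

  -- By closure under subsets, each point of a simplex is itself a vertex of the complex, so testing
  -- vertices is as fine as testing points.
  vertices-determine : ∀ {i} (σ τ : Simplex X i) → (∀ (v : Vertex X) → v ≼ σ ⇔ v ≼ τ) → σ ≡ τ
  vertices-determine σ τ same = simplex-≡ (⊆-antisym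
    (λ {p} p∈σ → Equivalence.to   (same (vertexAt σ p∈σ)) (⁅x⁆⊆p p∈σ) (x∈⁅x⁆ p))
    (λ {p} p∈τ → Equivalence.from (same (vertexAt τ p∈τ)) (⁅x⁆⊆p p∈τ) (x∈⁅x⁆ p)))

  ShareTwoVertices : Face X → Face X → Set
  ShareTwoVertices F G =
    Σ[ v ∈ Vertex X ] Σ[ w ∈ Vertex X ] (v ≢ w × (v ≼ F × v ≼ G) × (w ≼ F × w ≼ G))

  shareEdge⇒shareTwoVertices : ∀ {F G} → ShareEdge X F G → ShareTwoVertices F G
  shareEdge⇒shareTwoVertices (e@(s , _ , ∣s∣≡2) , e⊑F , e⊑G) =
    let p , q , p≢q , p∈s , q∈s = ∣p∣>1⇒distinct s (subst (1 <_) (sym ∣s∣≡2) (s<s z<s))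
    in vertexAt e p∈s , vertexAt e q∈s
     , (λ v≡w → p≢q (x∈⁅y⁆⇒x≡y q (subst (λ v → p ∈ proj₁ v) v≡w (x∈⁅x⁆ p))))
     , (⁅x⁆⊆p (e⊑F p∈s) , ⁅x⁆⊆p (e⊑G p∈s))
     , (⁅x⁆⊆p (e⊑F q∈s) , ⁅x⁆⊆p (e⊑G q∈s))

  -- The two points span the edge. It belongs to the complex because it is a subset of the face `F`.
  shareTwoVertices⇒shareEdge : ∀ {F G} → ShareTwoVertices F G → ShareEdge X F G
  shareTwoVertices⇒shareEdge {_ , F∈X , _} (v , w , v≢w , (v⊑F , v⊑G) , (w⊑F , w⊑G)) =
    let p , p∈v = point v
        q , q∈w = point w
        p≢q = λ p≡q → v≢w (vertex-≡ p∈v (subst (_∈ proj₁ w) (sym p≡q) q∈w))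
    in ( ⁅ p ⁆ ∪ ⁅ q ⁆
       , closed (⁅x⁆∪⁅y⁆⊆p (v⊑F p∈v) (w⊑F q∈w)) F∈X
       , ∣⁅x⁆∪⁅y⁆∣≡2 p≢q )
     , ⁅x⁆∪⁅y⁆⊆p (v⊑F p∈v) (w⊑F q∈w)
     , ⁅x⁆∪⁅y⁆⊆p (v⊑G p∈v) (w⊑G q∈w)

  isImage-unique : ∀ {f s t t′} → IsImage X f s t → IsImage X f s t′ → t ≡ t′
  isImage-unique im im′ = ⊆-antisym
    (λ {p} → Equivalence.from (im′ p) ∘ Equivalence.to (im p))
    (λ {p} → Equivalence.from (im p) ∘ Equivalence.to (im′ p))

  module _ (α : ComplexAut X) where

    open ComplexAut α

    private
      to-injective : Injective _≡_ _≡_ to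
      to-injective = Injection.injective (↔⇒↣ permutation)

      from-injective : Injective _≡_ _≡_ from
      from-injective = Injection.injective (↔⇒↣ (↔-sym permutation))

    faceMap : Face X → Face X
    faceMap F = proj₁ (mapsFaces F)

    to-⊑⁺ : ∀ {F v} → v ≼ F → to v ≼ faceMap F
    to-⊑⁺ {F} {v} v⊑F {p} p∈ = Equivalence.from (proj₂ (mapsFaces F) p) (v , v⊑F , p∈)

    -- A point of `to v` lies in the image of `F`, hence in `to w` for some vertex `w` of `F`. Then
    -- `to w` and `to v` share a point and coincide, and injectivity of `to` gives `w ≡ v`.
    to-⊑⁻ : ∀ {F v} → to v ≼ faceMap F → v ≼ F
    to-⊑⁻ {F} {v} tov⊑ =
      let p , p∈tov = point (to v)
          w , w⊑F , p∈tow = Equivalence.to (proj₂ (mapsFaces F) p) (tov⊑ p∈tov)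
      in subst (_≼ F) (to-injective (vertex-≡ p∈tow p∈tov)) w⊑F

    from-⊑ : ∀ {F v} → v ≼ faceMap F → from v ≼ F
    from-⊑ {F} {v} v⊑ = to-⊑⁻ {F} {from v}
      (subst (_≼ faceMap F) (sym (Inverse.strictlyInverseˡ permutation v)) v⊑)

    -- The vertices of `F` are exactly those that `to` sends into `faceMap F`, so the image
    -- determines `F`.
    faceMap-injective : Injective _≡_ _≡_ faceMap
    faceMap-injective {F} {G} eq = vertices-determine F G λ v → mk⇔ {A = v ≼ F} {B = v ≼ G}
      (λ v⊑F → to-⊑⁻ {G} {v} (subst (to v ≼_) eq       (to-⊑⁺ {F} {v} v⊑F)))
      (λ v⊑G → to-⊑⁻ {F} {v} (subst (to v ≼_) (sym eq) (to-⊑⁺ {G} {v} v⊑G)))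

    faceMap-shareEdge⁺ : ∀ {F G} → ShareEdge X F G → ShareEdge X (faceMap F) (faceMap G)
    faceMap-shareEdge⁺ {F} {G} sh
      with v , w , v≢w , (v⊑F , v⊑G) , (w⊑F , w⊑G) ← shareEdge⇒shareTwoVertices {F} {G} sh
      = shareTwoVertices⇒shareEdge {faceMap F} {faceMap G}
           ( to v , to w , v≢w ∘ to-injective
           , (to-⊑⁺ {F} {v} v⊑F , to-⊑⁺ {G} {v} v⊑G)
           , (to-⊑⁺ {F} {w} w⊑F , to-⊑⁺ {G} {w} w⊑G) )

    -- Common vertices are pulled back along `from`, used purely as a vertex map: whether it sends
    -- faces to faces never has to be checked.
    faceMap-shareEdge⁻ : ∀ {F G} → ShareEdge X (faceMap F) (faceMap G) → ShareEdge X F G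
    faceMap-shareEdge⁻ {F} {G} sh
      with v , w , v≢w , (v⊑F , v⊑G) , (w⊑F , w⊑G) ← shareEdge⇒shareTwoVertices {faceMap F} {faceMap G} sh
      = shareTwoVertices⇒shareEdge {F} {G}
           ( from v , from w , v≢w ∘ from-injective
           , (from-⊑ {F} {v} v⊑F , from-⊑ {G} {v} v⊑G)
           , (from-⊑ {F} {w} w⊑F , from-⊑ {G} {w} w⊑G) )
    faceGraphAut : GraphAut (faceGraph X)
    faceGraphAut = record
      -- The inverse picks the preimage supplied by `onto`. It is a right inverse by construction,
      -- and a left inverse after cancelling `faceMap`.
      { permutation = mk↔ₛ′ faceMap (proj₁ ∘ onto) (proj₂ ∘ onto)
          (λ F → faceMap-injective (proj₂ (onto (faceMap F))))
      ; adjacency = λ F G → mk⇔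
          (λ (F≢G , sh) → F≢G ∘ faceMap-injective , faceMap-shareEdge⁺ {F} {G} sh)
          (λ (F≢G , sh) → F≢G ∘ cong faceMap , faceMap-shareEdge⁻ {F} {G} sh)
      }
      where
      onto : StrictlySurjective _≡_ faceMap
      onto = finite-injective⇒surjective (encode ∘ proj₁) simplex-encode-injective faceMap faceMap-injective

proposition3p2 : (n : ℕ) .{{_ : NonZero n}} (X : SimplicialComplex n) →
    IsSimplicialSurface X → FaceTransitive X → NodeTransitive (faceGraph X)
proposition3p2 n X _ transitive F G =
  let α , imG = transitive F G
  -- Transitivity says that `G` is an image of `F` under `α`, while `faceMap` uses the image chosen
  -- by `mapsFaces`. Uniqueness of images identifies the two.
  in faceGraphAut X α , simplex-≡ X (isImage-unique X {ComplexAut.to α} (proj₂ (ComplexAut.mapsFaces α F)) imG)
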